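{- Let $\alpha$ be a non-zero real number and let $k\in\mathbb{N}\setminus\{0,1\}$. The function $\mathbb{N}\to\mathbb{R}$, $n\mapsto\alpha\,k^n$, is not uniformly close to any function $\mathbb{N}\to\mathbb{Z}$ having integral difference ratios.
   Context: $\mathbb{N}$ denotes the non-negative integers. A function $f:\mathbb{N}\to\mathbb{Z}$ has integral difference ratios if $a-b$ divides $f(a)-f(b)$ for all $a,b\in\mathbb{N}$ with $a\neq b$. Two functions $f,g:\mathbb{N}\to\mathbb{R}$ are uniformly close if $f-g$ is bounded, i.e. there exists $M$ such that $|f(x)-g(x)|\leq M$ for all $x\in\mathbb{N}$. -}

module Defs where

open import Algebra.Bundles using (CommutativeRing)
import Algebra.Properties.AbelianGroup as AbelianGroupProperties
import Algebra.Properties.CommutativeSemigroup as CommutativeSemigroupProperties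
import Algebra.Properties.Ring as RingProperties
open import Data.Integer.Base as ℤ using (ℤ)
open import Data.Integer.Divisibility.Signed using (_∣_)
open import Data.Nat.Base as ℕ using (ℕ; _⊔_)
open import Data.Nat.Properties as ℕₚ using (m≤m⊔n; m≤n⊔m)
open import Data.Product.Base using (∃-syntax; _×_; _,_; proj₁; proj₂)
open import Data.Rational.Base as ℚ
  using (ℚ; 0ℚ; 1ℚ; ½; 1/_; _+_; _*_; _-_; -_; ∣_∣; _<_; _≤_; Positive; NonNegative)
open import Data.Rational.Properties
open import Data.Sum.Base using (inj₁; inj₂)
open import Relation.Binary.PropositionalEquality
  using (_≡_; _≢_; refl; sym; trans; cong; cong₂; subst; subst₂)

-- The standard library has no real numbers.  They are built here as Cauchy
-- sequences of rationals.  As there are no quotients, equality of reals is the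
-- relation _≃_, not _≡_.

Cauchy : (ℕ → ℚ) → Set
Cauchy x = ∀ ε → 0ℚ < ε → ∃[ N ] (∀ m n → N ℕ.≤ m → N ℕ.≤ n → ∣ x m - x n ∣ < ε)

record ℝ : Set where
  constructor mkℝ
  field
    seq    : ℕ → ℚ
    cauchy : Cauchy seq

open ℝ public

module CauchyLemmas where

  private
    module +ₚ = AbelianGroupProperties +-0-abelianGroup
    module +ₛ = CommutativeSemigroupProperties
      (CommutativeRing.+-commutativeSemigroup +-*-commutativeRing)
    module Rₚ = RingProperties (CommutativeRing.ring +-*-commutativeRing)

  0<½* : ∀ {ε} → 0ℚ < ε → 0ℚ < ½ * ε
  0<½* {ε} 0<ε = subst (_< ½ * ε) (*-zeroʳ ½) (*-monoʳ-<-pos ½ 0<ε)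

  ½+½ : ∀ ε → ½ * ε + ½ * ε ≡ ε
  ½+½ ε = trans (sym (*-distribʳ-+ ε ½ ½)) (*-identityˡ ε)

  p≡[p-q]+q : ∀ p q → p ≡ (p - q) + q
  p≡[p-q]+q p q = sym (+ₚ.//-rightDividesˡ q p)

  ∣-∣-swap : ∀ p q → ∣ p - q ∣ ≡ ∣ q - p ∣
  ∣-∣-swap p q = trans (sym (∣-p∣≡∣p∣ (p - q))) (cong ∣_∣ (+ₚ.⁻¹-anti-homo‿- p q))

  ∣p∣-∣q∣≤∣p-q∣ : ∀ p q → ∣ p ∣ - ∣ q ∣ ≤ ∣ p - q ∣
  ∣p∣-∣q∣≤∣p-q∣ p q = begin
    ∣ p ∣ - ∣ q ∣               ≡⟨ cong (λ r → ∣ r ∣ - ∣ q ∣) (p≡[p-q]+q p q) ⟩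
    ∣ (p - q) + q ∣ - ∣ q ∣     ≤⟨ +-monoˡ-≤ (- ∣ q ∣) (∣p+q∣≤∣p∣+∣q∣ (p - q) q) ⟩
    ∣ p - q ∣ + ∣ q ∣ - ∣ q ∣   ≡⟨ +ₚ.//-rightDividesʳ ∣ q ∣ ∣ p - q ∣ ⟩
    ∣ p - q ∣                   ∎
    where open ≤-Reasoning

  ∣∣p∣-∣q∣∣≤∣p-q∣ : ∀ p q → ∣ ∣ p ∣ - ∣ q ∣ ∣ ≤ ∣ p - q ∣
  ∣∣p∣-∣q∣∣≤∣p-q∣ p q with ∣p∣≡p∨∣p∣≡-p (∣ p ∣ - ∣ q ∣)
  ... | inj₁ eq = subst (_≤ ∣ p - q ∣) (sym eq) (∣p∣-∣q∣≤∣p-q∣ p q)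
  ... | inj₂ eq = subst₂ _≤_ (sym (trans eq (+ₚ.⁻¹-anti-homo‿- ∣ p ∣ ∣ q ∣))) (∣-∣-swap q p)
                        (∣p∣-∣q∣≤∣p-q∣ q p)

  const-cauchy : ∀ q → Cauchy (λ _ → q)
  const-cauchy q ε 0<ε = 0 , λ _ _ _ _ → subst (_< ε) (sym (cong ∣_∣ (+-inverseʳ q))) 0<ε

  +-cauchy : ∀ {x y} → Cauchy x → Cauchy y → Cauchy (λ n → x n + y n)
  +-cauchy {x} {y} cx cy ε 0<ε with cx (½ * ε) (0<½* 0<ε) | cy (½ * ε) (0<½* 0<ε)
  ... | N₁ , p | N₂ , q = N₁ ⊔ N₂ , λ m n N≤m N≤n → begin-strict
    ∣ (x m + y m) - (x n + y n) ∣     ≡⟨ cong ∣_∣ (lemma (x m) (y m) (x n) (y n)) ⟩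
    ∣ (x m - x n) + (y m - y n) ∣     ≤⟨ ∣p+q∣≤∣p∣+∣q∣ (x m - x n) (y m - y n) ⟩
    ∣ x m - x n ∣ + ∣ y m - y n ∣     <⟨ +-mono-<
        (p m n (ℕₚ.≤-trans (m≤m⊔n N₁ N₂) N≤m) (ℕₚ.≤-trans (m≤m⊔n N₁ N₂) N≤n))
        (q m n (ℕₚ.≤-trans (m≤n⊔m N₁ N₂) N≤m) (ℕₚ.≤-trans (m≤n⊔m N₁ N₂) N≤n)) ⟩
    ½ * ε + ½ * ε                     ≡⟨ ½+½ ε ⟩
    ε                                 ∎
    where
    open ≤-Reasoning
    lemma : ∀ a b c d → (a + b) - (c + d) ≡ (a - c) + (b - d)
    lemma a b c d = trans (cong ((a + b) +_) (neg-distrib-+ c d)) (+ₛ.interchange a b (- c) (- d))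

  neg-cauchy : ∀ {x} → Cauchy x → Cauchy (λ n → - x n)
  neg-cauchy {x} cx ε 0<ε with cx ε 0<ε
  ... | N , p = N , λ m n N≤m N≤n →
    subst (_< ε) (trans (sym (∣-p∣≡∣p∣ (x m - x n))) (cong ∣_∣ (neg-distrib-+ (x m) (- x n))))
      (p m n N≤m N≤n)

  abs-cauchy : ∀ {x} → Cauchy x → Cauchy (λ n → ∣ x n ∣)
  abs-cauchy {x} cx ε 0<ε with cx ε 0<ε
  ... | N , p = N , λ m n N≤m N≤n →
    ≤-<-trans (∣∣p∣-∣q∣∣≤∣p-q∣ (x m) (x n)) (p m n N≤m N≤n)

  bounded : ∀ {x} → Cauchy x →
            ∃[ B ] Positive B × ∃[ N ] (∀ n → N ℕ.≤ n → ∣ x n ∣ ≤ B)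
  bounded {x} cx with cx 1ℚ (positive⁻¹ 1ℚ)
  ... | N , p = 1ℚ + ∣ x N ∣
              , pos+nonNeg⇒pos 1ℚ ∣ x N ∣ {{∣-∣-nonNeg (x N)}}
              , N , λ n N≤n → begin
    ∣ x n ∣                     ≡⟨ cong ∣_∣ (p≡[p-q]+q (x n) (x N)) ⟩
    ∣ (x n - x N) + x N ∣       ≤⟨ ∣p+q∣≤∣p∣+∣q∣ (x n - x N) (x N) ⟩
    ∣ x n - x N ∣ + ∣ x N ∣     ≤⟨ +-monoˡ-≤ ∣ x N ∣ (<⇒≤ (p n N N≤n ℕₚ.≤-refl)) ⟩
    1ℚ + ∣ x N ∣                ∎
    where open ≤-Reasoning

  *-mono-∣∣ : ∀ p q {B δ} → Positive B → ∣ p ∣ ≤ B → ∣ q ∣ < δ → ∣ p * q ∣ < B * δ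
  *-mono-∣∣ p q {B} {δ} posB p≤B q<δ = begin-strict
    ∣ p * q ∣       ≡⟨ ∣p*q∣≡∣p∣*∣q∣ p q ⟩
    ∣ p ∣ * ∣ q ∣   ≤⟨ *-monoʳ-≤-nonNeg ∣ q ∣ {{∣-∣-nonNeg q}} p≤B ⟩
    B * ∣ q ∣       <⟨ *-monoʳ-<-pos B {{posB}} q<δ ⟩
    B * δ           ∎
    where open ≤-Reasoning

  *-cauchy : ∀ {x y} → Cauchy x → Cauchy y → Cauchy (λ n → x n * y n)
  *-cauchy {x} {y} cx cy ε 0<ε with bounded cx | bounded cy
  ... | A , posA , N₁ , p | B , posB , N₂ , q = N , λ m n N≤m N≤n → begin-strict
    ∣ x m * y m - x n * y n ∣
      ≡⟨ cong ∣_∣ (lemma (x m) (y m) (x n) (y n)) ⟩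
    ∣ x m * (y m - y n) + y n * (x m - x n) ∣
      ≤⟨ ∣p+q∣≤∣p∣+∣q∣ (x m * (y m - y n)) (y n * (x m - x n)) ⟩
    ∣ x m * (y m - y n) ∣ + ∣ y n * (x m - x n) ∣
      <⟨ +-mono-<
           (*-mono-∣∣ (x m) (y m - y n) posA (p m (≥N₁ N≤m))
             (proj₂ modY m n (≥N₄ N≤m) (≥N₄ N≤n)))
           (*-mono-∣∣ (y n) (x m - x n) posB (q n (≥N₂ N≤n))
             (proj₂ modX m n (≥N₃ N≤m) (≥N₃ N≤n))) ⟩
    A * δ + B * δ
      ≡⟨ sym (*-distribʳ-+ δ A B) ⟩
    C * δ
      ≡⟨ sym (*-assoc C (1/ C) ε) ⟩
    C * 1/ C * ε
      ≡⟨ cong (_* ε) (*-inverseʳ C) ⟩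
    1ℚ * ε
      ≡⟨ *-identityˡ ε ⟩
    ε ∎
    where
    open ≤-Reasoning
    lemma : ∀ a b c d → a * b - c * d ≡ a * (b - d) + d * (a - c)
    lemma a b c d = begin-equality
      a * b - c * d                        ≡⟨ cong (_- c * d) (p≡[p-q]+q (a * b) (a * d)) ⟩
      (a * b - a * d) + a * d - c * d      ≡⟨ +-assoc (a * b - a * d) (a * d) (- (c * d)) ⟩
      (a * b - a * d) + (a * d - c * d)    ≡⟨ cong₂ _+_ (sym (Rₚ.x[y-z]≈xy-xz a b d))
                                                        (sym (Rₚ.[y-z]x≈yx-zx d a c)) ⟩
      a * (b - d) + (a - c) * d            ≡⟨ cong (a * (b - d) +_) (*-comm (a - c) d) ⟩
      a * (b - d) + d * (a - c)            ∎

    C : ℚ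
    C = A + B

    instance
      posC : Positive C
      posC = pos+pos⇒pos A {{posA}} B {{posB}}

      nonZeroC : ℚ.NonZero C
      nonZeroC = pos⇒nonZero C

    δ : ℚ
    δ = 1/ C * ε

    0<δ : 0ℚ < δ
    0<δ = subst (_< δ) (*-zeroʳ (1/ C)) (*-monoʳ-<-pos (1/ C) {{1/pos⇒pos C}} 0<ε)

    modX = cx δ 0<δ
    modY = cy δ 0<δ
    N₃ = proj₁ modX
    N₄ = proj₁ modY
    N = (N₁ ⊔ N₂) ⊔ (N₃ ⊔ N₄)

    ≥N₁ : ∀ {m} → N ℕ.≤ m → N₁ ℕ.≤ m
    ≥N₁ h = ℕₚ.≤-trans (m≤m⊔n N₁ N₂) (ℕₚ.≤-trans (m≤m⊔n (N₁ ⊔ N₂) (N₃ ⊔ N₄)) h)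
    ≥N₂ : ∀ {m} → N ℕ.≤ m → N₂ ℕ.≤ m
    ≥N₂ h = ℕₚ.≤-trans (m≤n⊔m N₁ N₂) (ℕₚ.≤-trans (m≤m⊔n (N₁ ⊔ N₂) (N₃ ⊔ N₄)) h)
    ≥N₃ : ∀ {m} → N ℕ.≤ m → N₃ ℕ.≤ m
    ≥N₃ h = ℕₚ.≤-trans (m≤m⊔n N₃ N₄) (ℕₚ.≤-trans (m≤n⊔m (N₁ ⊔ N₂) (N₃ ⊔ N₄)) h)
    ≥N₄ : ∀ {m} → N ℕ.≤ m → N₄ ℕ.≤ m
    ≥N₄ h = ℕₚ.≤-trans (m≤n⊔m N₃ N₄) (ℕₚ.≤-trans (m≤n⊔m (N₁ ⊔ N₂) (N₃ ⊔ N₄)) h)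

open CauchyLemmas

infix  4 _≃_ _≤ℝ_
infixl 6 _+ℝ_ _-ℝ_
infixl 7 _*ℝ_
infix  8 -ℝ_

_≃_ : ℝ → ℝ → Set
x ≃ y = ∀ ε → 0ℚ < ε → ∃[ N ] (∀ n → N ℕ.≤ n → ∣ seq x n - seq y n ∣ < ε)

-- Compares limits: representatives of equal reals need not be eventually
-- termwise ≤, hence the slack ε.
_≤ℝ_ : ℝ → ℝ → Set
x ≤ℝ y = ∀ ε → 0ℚ < ε → ∃[ N ] (∀ n → N ℕ.≤ n → seq x n ≤ seq y n + ε)

fromℚ : ℚ → ℝ
fromℚ q = mkℝ (λ _ → q) (const-cauchy q)

fromℤ : ℤ → ℝ
fromℤ i = fromℚ (i ℚ./ 1)

fromℕ : ℕ → ℝ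
fromℕ n = fromℤ (ℤ.+ n)

0ℝ : ℝ
0ℝ = fromℕ 0

_+ℝ_ : ℝ → ℝ → ℝ
x +ℝ y = mkℝ (λ n → seq x n + seq y n) (+-cauchy {seq x} {seq y} (cauchy x) (cauchy y))

-ℝ_ : ℝ → ℝ
-ℝ x = mkℝ (λ n → - seq x n) (neg-cauchy {seq x} (cauchy x))

_-ℝ_ : ℝ → ℝ → ℝ
x -ℝ y = x +ℝ (-ℝ y)

_*ℝ_ : ℝ → ℝ → ℝ
x *ℝ y = mkℝ (λ n → seq x n * seq y n) (*-cauchy {seq x} {seq y} (cauchy x) (cauchy y))

∣_∣ℝ : ℝ → ℝ
∣ x ∣ℝ = mkℝ (λ n → ∣ seq x n ∣) (abs-cauchy {seq x} (cauchy x))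

IntegralDifferenceRatios : (ℕ → ℤ) → Set
IntegralDifferenceRatios f = ∀ a b → a ≢ b → (ℤ.+ a ℤ.- ℤ.+ b) ∣ (f a ℤ.- f b)

UniformlyClose : (ℕ → ℝ) → (ℕ → ℝ) → Set
UniformlyClose f g = ∃[ M ] (∀ x → ∣ f x -ℝ g x ∣ℝ ≤ℝ M)

{-# OPTIONS --safe #-}
-- If α k ^ n is within a bounded distance of f n, then f (n + 1) - k f n is
-- bounded.  It also has integral difference ratios, and a bounded function with
-- integral difference ratios is constant, since f c = f a once c - a exceeds the
-- diameter of the range.  So d n = f (n + 1) - f n satisfies d (n + 1) = k d n;
-- then every power of k divides d 0, hence d = 0 and f is constant.  Now α k ^ n
-- is bounded, which forces α ≃ 0.

module Submission where

import Algebra.Properties.CommutativeSemigroup as CommutativeSemigroupProperties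
open import Data.Integer.Base as ℤ using (ℤ; 0ℤ)
open import Data.Integer.Divisibility.Signed
  using (_∣_; ∣⇒∣ᵤ; ∣ᵤ⇒∣; ∣m∣n⇒∣m-n; ∣n⇒∣m*n; ∣m⇒∣m*n)
import Data.Integer.Properties as ℤₚ
open import Data.Integer.Tactic.RingSolver using (solve-∀)
open import Data.Nat.Base as ℕ using (ℕ; zero; suc; _^_; _⊔_)
import Data.Nat.Coprimality as Coprimality
import Data.Nat.Divisibility as ℕ∣
import Data.Nat.Properties as ℕₚ
open import Data.Product.Base using (∃-syntax; _×_; _,_; proj₁; proj₂)
open import Data.Rational.Base as ℚ using (ℚ; mkℚ; 0ℚ; 1ℚ)
import Data.Rational.Properties as ℚₚ
open import Data.Rational.Solver using (module +-*-Solver)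
open import Data.Sum.Base using (inj₁; inj₂)
open import Function.Base using (_∘_)
open import Relation.Binary.PropositionalEquality
  using (_≡_; _≢_; refl; sym; trans; cong; cong₂; subst; subst₂; module ≡-Reasoning)
open import Relation.Nullary.Negation.Core using (¬_)
open import Defs

-- Divisibility and growth of powers.

∣∧<⇒≡0 : ∀ {i j} → i ∣ j → ℤ.∣ j ∣ ℕ.< ℤ.∣ i ∣ → j ≡ 0ℤ
∣∧<⇒≡0 {i} {ℤ.+0}        i∣j j<i = refl
∣∧<⇒≡0 {i} {ℤ.+[1+ _ ]}  i∣j j<i with () ← ℕ∣.>⇒∤ j<i (∣⇒∣ᵤ i∣j)
∣∧<⇒≡0 {i} {ℤ.-[1+ _ ]}  i∣j j<i with () ← ℕ∣.>⇒∤ j<i (∣⇒∣ᵤ i∣j)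

-- The induction hypothesis says `suc m ≤ k ^ m`, and one more factor `k` is a strict increase. This
-- makes powers of `k` outgrow both a fixed integer and a fixed rational.
m<k^m : ∀ {k} → 1 ℕ.< k → ∀ m → m ℕ.< k ^ m
m<k^m 1<k zero    = ℕ.s≤s ℕ.z≤n
m<k^m 1<k (suc m) = ℕₚ.≤-<-trans (m<k^m 1<k m) (ℕₚ.^-monoʳ-< _ 1<k (ℕₚ.n<1+n m))

k^m∣k^n : ∀ k {m n} → m ℕ.≤ n → k ^ m ℕ∣.∣ k ^ n
k^m∣k^n k {m} {n} m≤n = subst (λ o → k ^ m ℕ∣.∣ k ^ o) (ℕₚ.m+[n∸m]≡n m≤n)
  (subst (k ^ m ℕ∣.∣_) (sym (ℕₚ.^-distribˡ-+-* k m (n ℕ.∸ m))) (ℕ∣.m∣m*n _))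

-- Closure properties of integral difference ratios.

shift-idr : ∀ f → IntegralDifferenceRatios f → IntegralDifferenceRatios (f ∘ suc)
shift-idr f idr a b a≢b =
  subst (_∣ (f (suc a) ℤ.- f (suc b))) eq (idr (suc a) (suc b) (a≢b ∘ ℕₚ.suc-injective))
  where
  eq : ℤ.+ suc a ℤ.- ℤ.+ suc b ≡ ℤ.+ a ℤ.- ℤ.+ b
  eq = trans (ℤₚ.[1+m]⊖[1+n]≡m⊖n a b) (sym (ℤₚ.[+m]-[+n]≡m⊖n a b))

-‿idr : ∀ f g → IntegralDifferenceRatios f → IntegralDifferenceRatios g →
        IntegralDifferenceRatios (λ n → f n ℤ.- g n)
-‿idr f g idr-f idr-g a b a≢b =
  subst (_ ∣_) (eq (f a) (f b) (g a) (g b)) (∣m∣n⇒∣m-n (idr-f a b a≢b) (idr-g a b a≢b))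
  where
  eq : ∀ p q r s → (p ℤ.- q) ℤ.- (r ℤ.- s) ≡ (p ℤ.- r) ℤ.- (q ℤ.- s)
  eq = solve-∀

*-idr : ∀ i f → IntegralDifferenceRatios f → IntegralDifferenceRatios (λ n → i ℤ.* f n)
*-idr i f idr a b a≢b = subst (_ ∣_) (eq i (f a) (f b)) (∣n⇒∣m*n i (idr a b a≢b))
  where
  eq : ∀ i p q → i ℤ.* (p ℤ.- q) ≡ i ℤ.* p ℤ.- i ℤ.* q
  eq = solve-∀

-- Rigidity of bounded and of almost geometric functions.

module _ f {D} (idr : IntegralDifferenceRatios f) (f≤D : ∀ n → ℤ.∣ f n ∣ ℕ.≤ D) where

  -- The gap `m` divides the difference of the two values, which is at most `D + D` in absolute
  -- value and hence vanishes.
  bounded-idr-agree : ∀ a m → D ℕ.+ D ℕ.< m → f (a ℕ.+ m) ≡ f a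
  bounded-idr-agree a m 2D<m = ℤₚ.i-j≡0⇒i≡j (f c) (f a) (∣∧<⇒≡0 (idr c a c≢a) (begin-strict
    ℤ.∣ f c ℤ.- f a ∣               ≤⟨ ℤₚ.∣i-j∣≤∣i∣+∣j∣ (f c) (f a) ⟩
    ℤ.∣ f c ∣ ℕ.+ ℤ.∣ f a ∣         ≤⟨ ℕₚ.+-mono-≤ (f≤D c) (f≤D a) ⟩
    D ℕ.+ D                         <⟨ 2D<m ⟩
    m                               ≡⟨ cong ℤ.∣_∣ (eq (ℤ.+ a) (ℤ.+ m)) ⟨
    ℤ.∣ ℤ.+ c ℤ.- ℤ.+ a ∣           ∎))
    where
    open ℕₚ.≤-Reasoning
    c = a ℕ.+ m
    c≢a : c ≢ a
    c≢a = ℕₚ.>⇒≢ (ℕₚ.m<m+n a (ℕₚ.≤-<-trans ℕ.z≤n 2D<m))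
    eq : ∀ p q → (p ℤ.+ q) ℤ.- p ≡ q
    eq = solve-∀

  -- The points `a` and `b` may lie too close together to be compared directly, so both are compared
  -- with the common far point `a + b + m`.
  bounded-idr-constant : ∀ a b → f a ≡ f b
  bounded-idr-constant a b = begin
    f a                   ≡⟨ bounded-idr-agree a (b ℕ.+ m) (ℕₚ.m≤n+m m b) ⟨
    f (a ℕ.+ (b ℕ.+ m))   ≡⟨ cong f (x∙yz≈y∙xz a b m) ⟩
    f (b ℕ.+ (a ℕ.+ m))   ≡⟨ bounded-idr-agree b (a ℕ.+ m) (ℕₚ.m≤n+m m a) ⟩
    f b                   ∎
    where
    open ≡-Reasoning
    open CommutativeSemigroupProperties ℕₚ.+-commutativeSemigroup using (x∙yz≈y∙xz)
    m = suc (D ℕ.+ D)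

geometric : ∀ k (d : ℕ → ℤ) → (∀ n → d (suc n) ≡ ℤ.+ k ℤ.* d n) →
            ∀ n → d n ≡ ℤ.+ (k ^ n) ℤ.* d 0
geometric k d step zero    = sym (ℤₚ.*-identityˡ _)
geometric k d step (suc n) = begin
  d (suc n)                          ≡⟨ step n ⟩
  ℤ.+ k ℤ.* d n                      ≡⟨ cong (ℤ.+ k ℤ.*_) (geometric k d step n) ⟩
  ℤ.+ k ℤ.* (ℤ.+ (k ^ n) ℤ.* d 0)    ≡⟨ ℤₚ.*-assoc (ℤ.+ k) (ℤ.+ (k ^ n)) (d 0) ⟨
  ℤ.+ k ℤ.* ℤ.+ (k ^ n) ℤ.* d 0      ≡⟨ cong (ℤ._* d 0) (ℤₚ.pos-* k (k ^ n)) ⟨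
  ℤ.+ (k ^ suc n) ℤ.* d 0            ∎
  where open ≡-Reasoning

-- With a = k ^ m, both a ∣ d a - d 0 and a ∣ d a, so a ∣ d 0, where m is arbitrary.
geometric-idr-zero : ∀ {k} d → 1 ℕ.< k → IntegralDifferenceRatios d →
                     (∀ n → d (suc n) ≡ ℤ.+ k ℤ.* d n) → ∀ n → d n ≡ 0ℤ
geometric-idr-zero {k} d 1<k idr step n =
  trans (geometric k d step n) (trans (cong (ℤ.+ (k ^ n) ℤ.*_) d0≡0) (ℤₚ.*-zeroʳ (ℤ.+ (k ^ n))))
  where
  -- This exponent makes `k ^ m` exceed the absolute value of `d 0`, so that divisibility by `k ^ m`
  -- forces `d 0` to vanish.
  m = ℤ.∣ d 0 ∣
  a = k ^ m
  -- Here `a` is both divisor and index: `m ≤ a`, so `k ^ m` divides the factor `k ^ a` of `d a`.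
  a∣da : ℤ.+ a ∣ d a
  a∣da = subst (ℤ.+ a ∣_) (sym (geometric k d step a))
    (∣m⇒∣m*n {m = ℤ.+ (k ^ a)} (d 0) (∣ᵤ⇒∣ (k^m∣k^n k (ℕₚ.<⇒≤ (m<k^m 1<k m)))))
  a∣da-d0 : ℤ.+ a ∣ d a ℤ.- d 0
  a∣da-d0 = subst (_∣ (d a ℤ.- d 0)) (ℤₚ.+-identityʳ (ℤ.+ a))
    (idr a 0 (ℕₚ.>⇒≢ (ℕₚ.≤-<-trans ℕ.z≤n (m<k^m 1<k m))))
  eq : ∀ p q → p ℤ.- (p ℤ.- q) ≡ q
  eq = solve-∀
  d0≡0 : d 0 ≡ 0ℤ
  d0≡0 = ∣∧<⇒≡0 (subst (ℤ.+ a ∣_) (eq (d a) (d 0)) (∣m∣n⇒∣m-n a∣da a∣da-d0)) (m<k^m 1<k m)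

almost-geometric-idr-constant : ∀ {k} f {D} → 1 ℕ.< k → IntegralDifferenceRatios f →
  (∀ n → ℤ.∣ f (suc n) ℤ.- ℤ.+ k ℤ.* f n ∣ ℕ.≤ D) → ∀ n → f n ≡ f 0
almost-geometric-idr-constant {k} f {D} 1<k idr g≤D = go
  where
  g d : ℕ → ℤ
  g n = f (suc n) ℤ.- ℤ.+ k ℤ.* f n
  d n = f (suc n) ℤ.- f n

  -- With `p`, `q`, `r` three consecutive values of `f`, the recurrence for `d` fails by exactly
  -- `g (suc n) - g n`, which is zero once `g` is constant.
  eq : ∀ k p q r → r ℤ.- q ≡ k ℤ.* (q ℤ.- p) ℤ.+ ((r ℤ.- k ℤ.* q) ℤ.- (q ℤ.- k ℤ.* p))
  eq = solve-∀

  step : ∀ n → d (suc n) ≡ ℤ.+ k ℤ.* d n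
  step n = begin
    d (suc n)                                 ≡⟨ eq (ℤ.+ k) (f n) (f (suc n)) (f (suc (suc n))) ⟩
    ℤ.+ k ℤ.* d n ℤ.+ (g (suc n) ℤ.- g n)     ≡⟨ cong (λ i → ℤ.+ k ℤ.* d n ℤ.+ i)
                                                   (ℤₚ.i≡j⇒i-j≡0 (bounded-idr-constant g g-idr g≤D (suc n) n)) ⟩
    ℤ.+ k ℤ.* d n ℤ.+ 0ℤ                      ≡⟨ ℤₚ.+-identityʳ _ ⟩
    ℤ.+ k ℤ.* d n                             ∎
    where
    open ≡-Reasoning
    g-idr : IntegralDifferenceRatios g
    g-idr = -‿idr (f ∘ suc) (λ n → ℤ.+ k ℤ.* f n) (shift-idr f idr) (*-idr (ℤ.+ k) f idr)

  go : ∀ n → f n ≡ f 0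
  go zero    = refl
  go (suc n) = trans
    (ℤₚ.i-j≡0⇒i≡j _ _ (geometric-idr-zero d 1<k (-‿idr (f ∘ suc) f (shift-idr f idr) idr) step n)) (go n)

-- Integers inside the rationals.

ι : ℤ → ℚ
ι i = i ℚ./ 1

-- i / 1 is normalised by a gcd computation, which is stuck when i is a variable.
ι-mkℚ : ∀ i → ι i ≡ mkℚ i 0 (Coprimality.sym (Coprimality.1-coprimeTo ℤ.∣ i ∣))
ι-mkℚ i = ℚₚ.↥p/↧p≡p (mkℚ i 0 (Coprimality.sym (Coprimality.1-coprimeTo ℤ.∣ i ∣)))

ι-+ : ∀ i j → ι (i ℤ.+ j) ≡ ι i ℚ.+ ι j
ι-+ i j rewrite ι-mkℚ i | ι-mkℚ j =
  cong ι (sym (cong₂ ℤ._+_ (ℤₚ.*-identityʳ i) (ℤₚ.*-identityʳ j)))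

ι-* : ∀ i j → ι (i ℤ.* j) ≡ ι i ℚ.* ι j
ι-* i j rewrite ι-mkℚ i | ι-mkℚ j = refl

ι-neg : ∀ i → ι (ℤ.- i) ≡ ℚ.- ι i
ι-neg ℤ.+0       = refl
ι-neg ℤ.+[1+ n ] = refl
ι-neg ℤ.-[1+ n ] rewrite ι-mkℚ ℤ.+[1+ n ] = refl

ι-∣∣ : ∀ i → ι (ℤ.+ ℤ.∣ i ∣) ≡ ℚ.∣ ι i ∣
ι-∣∣ i rewrite ι-mkℚ i | ι-mkℚ (ℤ.+ ℤ.∣ i ∣) = refl

ι-mono-≤ : ∀ {i j} → i ℤ.≤ j → ι i ℚ.≤ ι j
ι-mono-≤ {i} {j} i≤j rewrite ι-mkℚ i | ι-mkℚ j =
  ℚ.*≤* (subst₂ ℤ._≤_ (sym (ℤₚ.*-identityʳ i)) (sym (ℤₚ.*-identityʳ j)) i≤j)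

ι-mono-< : ∀ {i j} → i ℤ.< j → ι i ℚ.< ι j
ι-mono-< {i} {j} i<j rewrite ι-mkℚ i | ι-mkℚ j =
  ℚ.*<* (subst₂ ℤ._<_ (sym (ℤₚ.*-identityʳ i)) (sym (ℤₚ.*-identityʳ j)) i<j)

ι-cancel-≤ : ∀ {i j} → ι i ℚ.≤ ι j → i ℤ.≤ j
ι-cancel-≤ {i} {j} i≤j rewrite ι-mkℚ i | ι-mkℚ j =
  subst₂ ℤ._≤_ (ℤₚ.*-identityʳ i) (ℤₚ.*-identityʳ j) (ℚₚ.drop-*≤* i≤j)

ι-nonNeg : ∀ n → ℚ.NonNegative (ι (ℤ.+ n))
ι-nonNeg n = ℚ.nonNegative (ι-mono-≤ {0ℤ} {ℤ.+ n} (ℤ.+≤+ ℕ.z≤n))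

p≤∣p∣ : ∀ p → p ℚ.≤ ℚ.∣ p ∣
p≤∣p∣ p with ℚₚ.≤-total 0ℚ p
... | inj₁ 0≤p = ℚₚ.≤-reflexive (sym (ℚₚ.0≤p⇒∣p∣≡p 0≤p))
... | inj₂ p≤0 = ℚₚ.≤-trans p≤0 (ℚₚ.0≤∣p∣ p)

-- The denominator is at least 1, so the absolute value of the numerator is a bound.
archimedean : ∀ p → ∃[ n ] p ℚ.≤ ι (ℤ.+ n)
archimedean p@(mkℚ i d-1 _) = n , ℚₚ.≤-trans (p≤∣p∣ p) ∣p∣≤n
  where
  n = ℤ.∣ i ∣
  ∣p∣≤n : ℚ.∣ p ∣ ℚ.≤ ι (ℤ.+ n)
  ∣p∣≤n rewrite ι-mkℚ (ℤ.+ n) = ℚ.*≤* (ℤₚ.*-monoˡ-≤-nonNeg (ℤ.+ n) (ℤ.+≤+ (ℕ.s≤s ℕ.z≤n)))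

-- From real estimates to integer estimates and back.

eventually-bounded : ∀ x → ∃[ D ] ∃[ N ] (∀ j → N ℕ.≤ j → seq x j ℚ.≤ ι (ℤ.+ D))
eventually-bounded x with CauchyLemmas.bounded (cauchy x)
... | B , _ , N , x≤B with archimedean B
... | D , B≤D = D , N , λ j N≤j → ℚₚ.≤-trans (p≤∣p∣ (seq x j)) (ℚₚ.≤-trans (x≤B j N≤j) B≤D)

-- A slack-free inequality between rationals at all late indices. The bound is a natural number so
-- that estimates can be carried back to integers.
EventuallyWithin : ℕ → (ℕ → ℚ) → ℤ → Set
EventuallyWithin D x i = ∃[ N ] (∀ j → N ℕ.≤ j → ℚ.∣ x j ℚ.- ι i ∣ ℚ.≤ ι (ℤ.+ D))

uniformlyClose⇒eventuallyWithin : ∀ f g → UniformlyClose f (fromℤ ∘ g) →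
  ∃[ D ] (∀ n → EventuallyWithin D (seq (f n)) (g n))
-- The extra 1 absorbs the slack in `≤ℝ`, taken to be 1. The bound is uniform in `n`, while the
-- threshold index depends on `n`.
uniformlyClose⇒eventuallyWithin f g (M , f-g≤M) = D ℕ.+ 1 ,
  λ n → within n (f-g≤M n 1ℚ (ℚₚ.positive⁻¹ 1ℚ))
  where
  D = proj₁ (eventually-bounded M)
  N = proj₁ (proj₂ (eventually-bounded M))
  M≤D = proj₂ (proj₂ (eventually-bounded M))
  within : ∀ n → ∃[ N′ ] (∀ j → N′ ℕ.≤ j → ℚ.∣ seq (f n) j ℚ.- ι (g n) ∣ ℚ.≤ seq M j ℚ.+ 1ℚ) →
           EventuallyWithin (D ℕ.+ 1) (seq (f n)) (g n)
  within n (N′ , h) = N ⊔ N′ , λ j N≤j → begin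
    ℚ.∣ seq (f n) j ℚ.- ι (g n) ∣     ≤⟨ h j (ℕₚ.≤-trans (ℕₚ.m≤n⊔m N N′) N≤j) ⟩
    seq M j ℚ.+ 1ℚ                    ≤⟨ ℚₚ.+-monoˡ-≤ 1ℚ (M≤D j (ℕₚ.≤-trans (ℕₚ.m≤m⊔n N N′) N≤j)) ⟩
    ι (ℤ.+ D) ℚ.+ 1ℚ                  ≡⟨ ι-+ (ℤ.+ D) (ℤ.+ 1) ⟨
    ι (ℤ.+ (D ℕ.+ 1))                 ∎
    where open ℚₚ.≤-Reasoning

-- In `k (α k ^ n - f n) - (α k ^ (n + 1) - f (n + 1))` the terms with `α` cancel, and the two
-- brackets are bounded by `D`.
within⇒almost-geometric : ∀ α k (f : ℕ → ℤ) D →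
  (∀ n → EventuallyWithin D (seq (α *ℝ fromℕ (k ^ n))) (f n)) →
  ∀ n → ℤ.∣ f (suc n) ℤ.- ℤ.+ k ℤ.* f n ∣ ℕ.≤ k ℕ.* D ℕ.+ D
within⇒almost-geometric α k f D within n with within n | within (suc n)
... | N , h | N′ , h′ = ℤₚ.drop‿+≤+ (ι-cancel-≤ {ℤ.+ ℤ.∣ v ℤ.- ℤ.+ k ℤ.* u ∣} {ℤ.+ (k ℕ.* D ℕ.+ D)} (begin
    ι (ℤ.+ ℤ.∣ v ℤ.- ℤ.+ k ℤ.* u ∣)         ≡⟨ ι-∣∣ (v ℤ.- ℤ.+ k ℤ.* u) ⟩
    ℚ.∣ ι (v ℤ.- ℤ.+ k ℤ.* u) ∣             ≡⟨ cong ℚ.∣_∣ eq ⟩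
    ℚ.∣ κ ℚ.* x ℚ.- y ∣                     ≤⟨ ℚₚ.∣p-q∣≤∣p∣+∣q∣ (κ ℚ.* x) y ⟩
    ℚ.∣ κ ℚ.* x ∣ ℚ.+ ℚ.∣ y ∣               ≡⟨ cong (ℚ._+ ℚ.∣ y ∣) (ℚₚ.∣p*q∣≡∣p∣*∣q∣ κ x) ⟩
    ℚ.∣ κ ∣ ℚ.* ℚ.∣ x ∣ ℚ.+ ℚ.∣ y ∣         ≡⟨ cong (λ z → z ℚ.* ℚ.∣ x ∣ ℚ.+ ℚ.∣ y ∣) (ι-∣∣ (ℤ.+ k)) ⟨
    κ ℚ.* ℚ.∣ x ∣ ℚ.+ ℚ.∣ y ∣               ≤⟨ ℚₚ.+-mono-≤
                                                 (ℚₚ.*-monoˡ-≤-nonNeg κ {{ι-nonNeg k}} (h j (ℕₚ.m≤m⊔n N N′)))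
                                                 (h′ j (ℕₚ.m≤n⊔m N N′)) ⟩
    κ ℚ.* ι (ℤ.+ D) ℚ.+ ι (ℤ.+ D)           ≡⟨ cong (ℚ._+ ι (ℤ.+ D)) (ι-* (ℤ.+ k) (ℤ.+ D)) ⟨
    ι (ℤ.+ k ℤ.* ℤ.+ D) ℚ.+ ι (ℤ.+ D)       ≡⟨ ι-+ (ℤ.+ k ℤ.* ℤ.+ D) (ℤ.+ D) ⟨
    ι (ℤ.+ k ℤ.* ℤ.+ D ℤ.+ ℤ.+ D)           ≡⟨ cong (λ z → ι (z ℤ.+ ℤ.+ D)) (ℤₚ.pos-* k D) ⟨
    ι (ℤ.+ (k ℕ.* D ℕ.+ D))                 ∎))
  where
  open ℚₚ.≤-Reasoning
  -- One index late enough for both `n` and `suc n` suffices, because the resulting inequality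
  -- between integers does not mention `j`.
  j = N ⊔ N′
  κ = ι (ℤ.+ k)
  u = f n
  v = f (suc n)
  a = seq α j
  c = ι (ℤ.+ (k ^ n))
  x = a ℚ.* c ℚ.- ι u
  y = a ℚ.* ι (ℤ.+ (k ^ suc n)) ℚ.- ι v
  open +-*-Solver using (solve; _:=_; _:-_; _:*_)
  eq : ι (v ℤ.- ℤ.+ k ℤ.* u) ≡ κ ℚ.* x ℚ.- y
  eq = begin-equality
    ι (v ℤ.- ℤ.+ k ℤ.* u)                   ≡⟨ ι-+ v (ℤ.- (ℤ.+ k ℤ.* u)) ⟩
    ι v ℚ.+ ι (ℤ.- (ℤ.+ k ℤ.* u))           ≡⟨ cong (ι v ℚ.+_) (ι-neg (ℤ.+ k ℤ.* u)) ⟩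
    ι v ℚ.- ι (ℤ.+ k ℤ.* u)                 ≡⟨ cong (λ z → ι v ℚ.- z) (ι-* (ℤ.+ k) u) ⟩
    ι v ℚ.- κ ℚ.* ι u
      ≡⟨ solve 5 (λ a c κ u v → v :- κ :* u := κ :* (a :* c :- u) :- (a :* (κ :* c) :- v))
           refl a c κ (ι u) (ι v) ⟩
    κ ℚ.* x ℚ.- (a ℚ.* (κ ℚ.* c) ℚ.- ι v)   ≡⟨ cong (λ z → κ ℚ.* x ℚ.- (a ℚ.* z ℚ.- ι v)) (ι-* (ℤ.+ k) (ℤ.+ (k ^ n))) ⟨
    κ ℚ.* x ℚ.- (a ℚ.* ι (ℤ.+ k ℤ.* ℤ.+ (k ^ n)) ℚ.- ι v)
      ≡⟨ cong (λ z → κ ℚ.* x ℚ.- (a ℚ.* ι z ℚ.- ι v)) (ℤₚ.pos-* k (k ^ n)) ⟨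
    κ ℚ.* x ℚ.- y                           ∎

-- Late terms of `α` times `k ^ n` are at most `E`, the sum of `D` and the absolute value of `i`.
-- Taking `n ≥ E / ε` gives `E ≤ n ε < k ^ n ε`, and cancelling `k ^ n` leaves less than `ε`.
bounded-geometric⇒zero : ∀ α k i D → 1 ℕ.< k →
  (∀ n → EventuallyWithin D (seq (α *ℝ fromℕ (k ^ n))) i) → α ≃ 0ℝ
bounded-geometric⇒zero α k i D 1<k within ε 0<ε
  with archimedean (ι (ℤ.+ (D ℕ.+ ℤ.∣ i ∣)) ℚ.* (ℚ.1/ ε) {{ε≢0}})
  where
  ε≢0 : ℚ.NonZero ε
  ε≢0 = ℚₚ.pos⇒nonZero ε {{ℚ.positive 0<ε}}
... | n , E/ε≤n with within n
... | N , h = N , λ j N≤j → subst (ℚ._< ε) (cong ℚ.∣_∣ (sym (ℚₚ.+-identityʳ (seq α j))))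
  (ℚₚ.*-cancelʳ-<-nonNeg c {{ι-nonNeg (k ^ n)}} (begin-strict
    ℚ.∣ seq α j ∣ ℚ.* c                         ≡⟨ cong (ℚ.∣ seq α j ∣ ℚ.*_) (ι-∣∣ (ℤ.+ (k ^ n))) ⟩
    ℚ.∣ seq α j ∣ ℚ.* ℚ.∣ c ∣                   ≡⟨ ℚₚ.∣p*q∣≡∣p∣*∣q∣ (seq α j) c ⟨
    ℚ.∣ seq α j ℚ.* c ∣                         ≡⟨ cong ℚ.∣_∣ (CauchyLemmas.p≡[p-q]+q (seq α j ℚ.* c) (ι i)) ⟩
    ℚ.∣ (seq α j ℚ.* c ℚ.- ι i) ℚ.+ ι i ∣       ≤⟨ ℚₚ.∣p+q∣≤∣p∣+∣q∣ (seq α j ℚ.* c ℚ.- ι i) (ι i) ⟩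
    ℚ.∣ seq α j ℚ.* c ℚ.- ι i ∣ ℚ.+ ℚ.∣ ι i ∣   ≤⟨ ℚₚ.+-mono-≤ (h j N≤j) (ℚₚ.≤-reflexive (sym (ι-∣∣ i))) ⟩
    ι (ℤ.+ D) ℚ.+ ι (ℤ.+ ℤ.∣ i ∣)               ≡⟨ ι-+ (ℤ.+ D) (ℤ.+ ℤ.∣ i ∣) ⟨
    E                                           ≡⟨ ℚₚ.*-identityʳ E ⟨
    E ℚ.* 1ℚ                                    ≡⟨ cong (E ℚ.*_) (ℚₚ.*-inverseˡ ε) ⟨
    E ℚ.* (ℚ.1/ ε ℚ.* ε)                        ≡⟨ ℚₚ.*-assoc E (ℚ.1/ ε) ε ⟨
    E ℚ.* ℚ.1/ ε ℚ.* ε                          ≤⟨ ℚₚ.*-monoʳ-≤-nonNeg ε {{ℚₚ.pos⇒nonNeg ε}} E/ε≤n ⟩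
    ι (ℤ.+ n) ℚ.* ε                             <⟨ ℚₚ.*-monoˡ-<-pos ε (ι-mono-< (ℤ.+<+ (m<k^m 1<k n))) ⟩
    c ℚ.* ε                                     ≡⟨ ℚₚ.*-comm c ε ⟩
    ε ℚ.* c                                     ∎))
  where
  open ℚₚ.≤-Reasoning
  E = ι (ℤ.+ (D ℕ.+ ℤ.∣ i ∣))
  c = ι (ℤ.+ (k ^ n))
  instance
    ε>0 : ℚ.Positive ε
    ε>0 = ℚ.positive 0<ε
    ε≢0 : ℚ.NonZero ε
    ε≢0 = ℚₚ.pos⇒nonZero ε

theorem4p17 : (α : ℝ) → ¬ (α ≃ 0ℝ) → (k : ℕ) → k ≢ 0 → k ≢ 1 →
    ¬ (∃[ f ] IntegralDifferenceRatios f × UniformlyClose (λ n → α *ℝ fromℕ (k ^ n)) (λ n → fromℤ (f n)))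
theorem4p17 α α≄0 k k≢0 k≢1 (f , idr , close) =
  refute (uniformlyClose⇒eventuallyWithin (λ n → α *ℝ fromℕ (k ^ n)) f close)
  where
  1<k : 1 ℕ.< k
  1<k = ℕₚ.≤∧≢⇒< (ℕₚ.n≢0⇒n>0 k≢0) (k≢1 ∘ sym)
  refute : ¬ (∃[ D ] (∀ n → EventuallyWithin D (seq (α *ℝ fromℕ (k ^ n))) (f n)))
  -- Since `f` is constant, the single integer `f 0` approximates every `α k ^ n` within `D`.
  refute (D , within) = α≄0 (bounded-geometric⇒zero α k (f 0) D 1<k λ n →
    subst (EventuallyWithin D (seq (α *ℝ fromℕ (k ^ n)))) (constant n) (within n))
    where
    constant : ∀ n → f n ≡ f 0
    constant = almost-geometric-idr-constant {k} f 1<k idr (within⇒almost-geometric α k f D within)
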